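{- Let $(B_n)_{n\ge 0}$ be the sequence of rational numbers defined by $B_0=1$ and $\sum_{k=0}^{n}\binom{n}{k}B_k=B_n$ for all integers $n>1$. Then for all integers $m,n>0$, $$(-1)^{m}\sum_{k=0}^{m}\binom{m}{k}B_{n+k}=(-1)^{n}\sum_{k=0}^{n}\binom{n}{k}B_{m+k}.$$
   Context: The numbers $B_n$ are the Bernoulli numbers (with the convention $B_1=-\tfrac12$, as follows from the defining relation for $n=2$). -}

module Defs where

open import Algebra.Bundles using (CommutativeRing)
open import Data.Fin.Base using (toℕ)
open import Data.Nat.Base using (ℕ; _>_)
open import Data.Nat.Combinatorics using (_C_)
open import Data.Rational.Base using (ℚ; 1ℚ)
open import Data.Rational.Properties using (+-*-commutativeRing)
open import Relation.Binary.PropositionalEquality.Core using (_≡_)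

open CommutativeRing +-*-commutativeRing using (semiring)

-- Summation with inclusive upper bound: in  ∑[ k ≤ n ] x  the index is
-- k : Fin (suc n), i.e. k runs over 0, …, n.
open import Algebra.Properties.Semiring.Sum semiring public using (sum⁺-syntax)

-- c × x is the natural multiple c · x of a rational x, and x ^ n is the
-- natural power of a rational x.
open import Algebra.Properties.Semiring.Mult semiring public using (_×_)
open import Algebra.Properties.Semiring.Exp semiring public using (_^_)

-- The recursion for n > 1 contains B n on both sides; cancelling it leaves
-- a relation that determines B (n - 1), so in particular B 1 = -1/2.
record IsBernoulli (B : ℕ → ℚ) : Set where
  field
    B₀      : B 0 ≡ 1ℚ
    B-recur : ∀ n → n > 1 → ∑[ k ≤ n ] ((n C toℕ k) × B (toℕ k)) ≡ B n

{-# OPTIONS --safe #-}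

-- Put T n m = ∑ₖ (m C k) B(n + k).  Both T and its signed transpose
-- (n , m) ↦ (-1)ⁿ⁺ᵐ T m n satisfy Pascal's rule A n (1+m) = A n m + A (1+n) m,
-- hence so does their difference A.  The Bernoulli recursion says
-- T 0 n = T n 0 for n > 1, which gives A 0 n = A n 0 for n > 1, and A 0 0 = 0.
-- These properties force A = 0 by induction on the antidiagonals: if A vanishes
-- on antidiagonal l, it is a constant e on antidiagonal 1+l, and
-- A 0 (2+l) = A (2+l) 0 + (2+l) e, so e = 0.
module Submission where

open import Defs
open import Algebra.Bundles using (CommutativeRing)
open import Data.Fin.Base using (Fin; toℕ; fromℕ; inject₁)
open import Data.Fin.Properties using (toℕ-fromℕ; toℕ-inject₁)
open import Data.Nat.Base using (ℕ; zero; suc; _+_; _>_; z<s; s<s)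
open import Data.Nat.Combinatorics using (_C_; nCk+nC[k+1]≡[n+1]C[k+1]; k>n⇒nCk≡0)
import Data.Nat.Properties as ℕ
open import Data.Rational.Base as ℚ using (ℚ; 0ℚ; 1ℚ; -_; _*_; _-_; Positive)
import Data.Rational.Properties as ℚ
open import Data.Rational.Solver using (module +-*-Solver)
open import Relation.Binary.PropositionalEquality

open CommutativeRing ℚ.+-*-commutativeRing using (semiring)
open import Algebra.Properties.Semiring.Sum semiring
  using (sum; sum-cong-≗; sum-init-last; ∑-distrib-+)
open import Algebra.Properties.Semiring.Mult semiring
  using (×-homo-1; ×-homo-+; ×-comm-*; ×-assoc-*)
open import Algebra.Properties.Semiring.Exp semiring using (^-homo-*)

open +-*-Solver using (solve; con; _:+_; _:*_; _:-_; _:=_)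
open ≡-Reasoning

×-zeroʳ : ∀ n → n × 0ℚ ≡ 0ℚ
×-zeroʳ n = trans (sym (×-comm-* n 0ℚ 0ℚ)) (ℚ.*-zeroˡ (n × 0ℚ))

suc×1-positive : ∀ n → Positive (suc n × 1ℚ)
suc×1-positive zero    = _
suc×1-positive (suc n) = ℚ.pos+pos⇒pos 1ℚ (suc n × 1ℚ) {{suc×1-positive n}}

-- Torsion-freeness of the rationals: `suc n × x` is the product of `x` with the positive rational
-- `suc n × 1ℚ`, which cancels from both inequalities.
suc×x≡0⇒x≡0 : ∀ n x → suc n × x ≡ 0ℚ → x ≡ 0ℚ
suc×x≡0⇒x≡0 n x nx≡0 = ℚ.≤-antisym
  (ℚ.*-cancelˡ-≤-pos c {{suc×1-positive n}} (ℚ.≤-reflexive cx≡c0))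
  (ℚ.*-cancelˡ-≤-pos c {{suc×1-positive n}} (ℚ.≤-reflexive (sym cx≡c0)))
  where
  c = suc n × 1ℚ
  cx≡c0 : c * x ≡ c * 0ℚ
  cx≡c0 = begin
    c * x             ≡⟨ ×-assoc-* (suc n) 1ℚ x ⟩
    suc n × (1ℚ * x)  ≡⟨ cong (suc n ×_) (ℚ.*-identityˡ x) ⟩
    suc n × x         ≡⟨ nx≡0 ⟩
    0ℚ                ≡⟨ ℚ.*-zeroʳ c ⟨
    c * 0ℚ            ∎

[-1]^n*[-1]^n≡1 : ∀ n → ((- 1ℚ) ^ n) * ((- 1ℚ) ^ n) ≡ 1ℚ
[-1]^n*[-1]^n≡1 zero    = refl
[-1]^n*[-1]^n≡1 (suc n) = trans
  (solve 1 (λ s → (con (- 1ℚ) :* s) :* (con (- 1ℚ) :* s) := s :* s) refl ((- 1ℚ) ^ n))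
  ([-1]^n*[-1]^n≡1 n)

Pascal : (ℕ → ℕ → ℚ) → Set
Pascal A = ∀ n m → A n (suc m) ≡ A n m ℚ.+ A (suc n) m

module _ (A : ℕ → ℕ → ℚ) (pascal : Pascal A) where

  -- Walking along antidiagonal `suc l` from its corner `A (suc l) 0`, each step adds one entry of
  -- antidiagonal `l`, which is `d`.
  next-antidiagonal : ∀ l d → (∀ i j → i + j ≡ l → A i j ≡ d) →
                      ∀ i j → i + j ≡ suc l → A i j ≡ A (suc l) 0 ℚ.+ j × d
  next-antidiagonal l d const i zero i+0≡1+l = begin
    A i 0                ≡⟨ cong (λ k → A k 0) (trans (sym (ℕ.+-identityʳ i)) i+0≡1+l) ⟩
    A (suc l) 0          ≡⟨ ℚ.+-identityʳ _ ⟨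
    A (suc l) 0 ℚ.+ 0ℚ   ∎
  next-antidiagonal l d const i (suc j) i+1+j≡1+l = begin
    A i (suc j)                          ≡⟨ pascal i j ⟩
    A i j ℚ.+ A (suc i) j                ≡⟨ cong₂ ℚ._+_ (const i j (ℕ.suc-injective 1+i+j≡1+l))
                                              (next-antidiagonal l d const (suc i) j 1+i+j≡1+l) ⟩
    d ℚ.+ (A (suc l) 0 ℚ.+ j × d)        ≡⟨ solve 3 (λ x y z → x :+ (y :+ z) := y :+ (x :+ z)) refl
                                              d (A (suc l) 0) (j × d) ⟩
    A (suc l) 0 ℚ.+ suc j × d            ∎
    where
    1+i+j≡1+l : suc i + j ≡ suc l
    1+i+j≡1+l = trans (sym (ℕ.+-suc i j)) i+1+j≡1+l

  pascal-symmetric-boundary⇒0 : A 0 0 ≡ 0ℚ → (∀ n → n > 1 → A 0 n ≡ A n 0) →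
                                ∀ l i j → i + j ≡ l → A i j ≡ 0ℚ
  pascal-symmetric-boundary⇒0 A00≡0 boundary zero    zero zero refl = A00≡0
  pascal-symmetric-boundary⇒0 A00≡0 boundary (suc l) i    j    i+j≡1+l =
    trans (constant i j i+j≡1+l) e≡0
    where
    e = A (suc l) 0

    constant : ∀ i j → i + j ≡ suc l → A i j ≡ e
    constant i j i+j≡1+l = begin
      A i j          ≡⟨ next-antidiagonal l 0ℚ (pascal-symmetric-boundary⇒0 A00≡0 boundary l)
                          i j i+j≡1+l ⟩
      e ℚ.+ j × 0ℚ   ≡⟨ cong (e ℚ.+_) (×-zeroʳ j) ⟩
      e ℚ.+ 0ℚ       ≡⟨ ℚ.+-identityʳ e ⟩
      e              ∎

    b = A (suc (suc l)) 0

    b+[2+l]×e≡b : b ℚ.+ suc (suc l) × e ≡ b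
    b+[2+l]×e≡b = trans
      -- The constant `e` is pinned down one antidiagonal further on: crossing it from corner to
      -- corner adds `e` exactly `2 + l` times, yet both corners agree.
      (sym (next-antidiagonal (suc l) e constant 0 (suc (suc l)) refl))
      (boundary (suc (suc l)) (s<s z<s))

    e≡0 : e ≡ 0ℚ
    e≡0 = suc×x≡0⇒x≡0 (suc l) e (begin
      suc (suc l) × e                ≡⟨ solve 2 (λ x y → y := (x :+ y) :- x) refl b _ ⟩
      (b ℚ.+ suc (suc l) × e) - b    ≡⟨ cong (_- b) b+[2+l]×e≡b ⟩
      b - b                          ≡⟨ ℚ.+-inverseʳ b ⟩
      0ℚ                             ∎)

binomialSum : (ℕ → ℚ) → ℕ → ℚ
binomialSum f m = ∑[ k ≤ m ] ((m C toℕ k) × f (toℕ k))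

-- Pascal's rule splits each term with positive index in two. The `lower` parts together with `f₀`
-- rebuild the sum for `f`, and the `upper` parts form the sum for the shifted sequence.
binomialSum-suc : ∀ f m →
  binomialSum f (suc m) ≡ binomialSum f m ℚ.+ binomialSum (λ k → f (suc k)) m
binomialSum-suc f m = begin
  f₀ ℚ.+ ∑[ k ≤ m ] ((suc m C suc (toℕ k)) × f (suc (toℕ k)))
    ≡⟨ cong (f₀ ℚ.+_) (sum-cong-≗ {suc m} λ k → trans
         (cong (_× f (suc (toℕ k))) (sym (nCk+nC[k+1]≡[n+1]C[k+1] m (toℕ k))))
         (×-homo-+ (f (suc (toℕ k))) (m C toℕ k) (m C suc (toℕ k)))) ⟩
  f₀ ℚ.+ ∑[ k ≤ m ] (upper k ℚ.+ lower k)
    ≡⟨ cong (f₀ ℚ.+_) (∑-distrib-+ {suc m} upper lower) ⟩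
  f₀ ℚ.+ (sum upper ℚ.+ sum lower)
    ≡⟨ solve 3 (λ x y z → x :+ (y :+ z) := (x :+ z) :+ y) refl f₀ (sum upper) (sum lower) ⟩
  ∑[ k ≤ suc m ] term (toℕ k) ℚ.+ sum upper
    ≡⟨ cong (ℚ._+ sum upper) extended-sum ⟩
  binomialSum f m ℚ.+ sum upper ∎
  where
  term : ℕ → ℚ
  term k = (m C k) × f k
  f₀ = 1 × f 0
  upper lower : Fin (suc m) → ℚ
  upper k = (m C toℕ k) × f (suc (toℕ k))
  lower k = term (suc (toℕ k))

  extended-sum : ∑[ k ≤ suc m ] term (toℕ k) ≡ binomialSum f m
  extended-sum = begin
    ∑[ k ≤ suc m ] term (toℕ k)
      ≡⟨ sum-init-last {suc m} (λ k → term (toℕ k)) ⟩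
    ∑[ k ≤ m ] term (toℕ (inject₁ k)) ℚ.+ term (toℕ (fromℕ (suc m)))
      ≡⟨ cong₂ ℚ._+_ (sum-cong-≗ {suc m} λ k → cong term (toℕ-inject₁ k))
           (cong term (toℕ-fromℕ (suc m))) ⟩
    binomialSum f m ℚ.+ (m C suc m) × f (suc m)
      -- The extra top term has coefficient `m C suc m`, which is zero.
      ≡⟨ cong (λ c → binomialSum f m ℚ.+ c × f (suc m)) (k>n⇒nCk≡0 (ℕ.n<1+n m)) ⟩
    binomialSum f m ℚ.+ 0ℚ
      ≡⟨ ℚ.+-identityʳ _ ⟩
    binomialSum f m ∎

binomialArray : (ℕ → ℚ) → ℕ → ℕ → ℚ
binomialArray f n m = binomialSum (λ k → f (n + k)) m

binomialArray-pascal : ∀ f → Pascal (binomialArray f)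
binomialArray-pascal f n m = trans
  (binomialSum-suc (λ k → f (n + k)) m)
  (cong (binomialArray f n m ℚ.+_)
    (sum-cong-≗ {suc m} λ k → cong (λ i → (m C toℕ k) × f i) (ℕ.+-suc n (toℕ k))))

binomialArray-0 : ∀ f n → binomialArray f n 0 ≡ f n
binomialArray-0 f n = begin
  1 × f (n + 0) ℚ.+ 0ℚ   ≡⟨ ℚ.+-identityʳ _ ⟩
  1 × f (n + 0)          ≡⟨ ×-homo-1 _ ⟩
  f (n + 0)              ≡⟨ cong f (ℕ.+-identityʳ n) ⟩
  f n                    ∎

signedTranspose : (ℕ → ℕ → ℚ) → ℕ → ℕ → ℚ
signedTranspose A n m = ((- 1ℚ) ^ (n + m)) * A m n

-- The two transposed entries on the right carry opposite signs `s` and `- s`. Expanding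
-- `A m (suc n)` as `x + c` cancels the `x` terms and leaves `- s * c`, the transposed entry on the
-- left.
pascal-minus-signedTranspose : ∀ A → Pascal A →
  Pascal (λ n m → A n m - signedTranspose A n m)
pascal-minus-signedTranspose A pascal n m = begin
  A n (suc m) - ((- 1ℚ) ^ (n + suc m)) * c
    ≡⟨ cong₂ (λ t k → t - ((- 1ℚ) ^ k) * c) (pascal n m) (ℕ.+-suc n m) ⟩
  (a ℚ.+ b) - (- 1ℚ * s) * c
    ≡⟨ solve 5 (λ a b c s x → (a :+ b) :- (con (- 1ℚ) :* s) :* c :=
         (a :- s :* x) :+ (b :- (con (- 1ℚ) :* s) :* (x :+ c))) refl a b c s x ⟩
  (a - s * x) ℚ.+ (b - (- 1ℚ * s) * (x ℚ.+ c))
    ≡⟨ cong (λ t → (a - s * x) ℚ.+ (b - (- 1ℚ * s) * t)) (pascal m n) ⟨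
  (a - s * x) ℚ.+ (b - (- 1ℚ * s) * A m (suc n)) ∎
  where
  a = A n m
  b = A (suc n) m
  c = A (suc m) n
  x = A m n
  s = (- 1ℚ) ^ (n + m)

pascal-signedSymmetric : ∀ A → Pascal A → (∀ n → n > 1 → A 0 n ≡ A n 0) →
                         ∀ n m → A n m ≡ signedTranspose A n m
pascal-signedSymmetric A pascal boundary n m = begin
  A n m                            ≡⟨ solve 2 (λ x y → x := (x :- y) :+ y) refl (A n m) S ⟩
  (A n m - S) ℚ.+ S                ≡⟨ cong (ℚ._+ S) (pascal-symmetric-boundary⇒0
                                        (λ i j → A i j - signedTranspose A i j)
                                        (pascal-minus-signedTranspose A pascal)
                                        origin boundary′ (n + m) n m refl) ⟩
  0ℚ ℚ.+ S                         ≡⟨ ℚ.+-identityˡ S ⟩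
  S                                ∎
  where
  S = signedTranspose A n m

  origin : A 0 0 - 1ℚ * A 0 0 ≡ 0ℚ
  origin = solve 1 (λ x → x :- con 1ℚ :* x := con 0ℚ) refl (A 0 0)

  boundary′ : ∀ k → k > 1 → A 0 k - signedTranspose A 0 k ≡ A k 0 - signedTranspose A k 0
  -- Both boundary positions have index sum `k`, hence the same sign.
  boundary′ k k>1 = cong₂ _-_ (boundary k k>1)
    (cong₂ (λ i x → ((- 1ℚ) ^ i) * x) (sym (ℕ.+-identityʳ k)) (sym (boundary k k>1)))

mainTheorem1 : (B : ℕ → ℚ) → IsBernoulli B →
    (m n : ℕ) → m > 0 → n > 0 →
    ((- 1ℚ) ^ m) * (∑[ k ≤ m ] ((m C toℕ k) × B (n + toℕ k)))
      ≡ ((- 1ℚ) ^ n) * (∑[ k ≤ n ] ((n C toℕ k) × B (m + toℕ k)))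
mainTheorem1 B isBernoulli m n _ _ = begin
  -- Signed symmetry contributes the factor `v * u`; its `u` squares away against the one in front.
  u * T n m                 ≡⟨ cong (u *_) (pascal-signedSymmetric T
                                 (binomialArray-pascal B) boundary n m) ⟩
  u * ((- 1ℚ) ^ (n + m) * T m n)
                            ≡⟨ cong (λ s → u * (s * T m n)) (^-homo-* (- 1ℚ) n m) ⟩
  u * ((v * u) * T m n)     ≡⟨ solve 3 (λ u v t → u :* ((v :* u) :* t) := (u :* u) :* (v :* t))
                                 refl u v (T m n) ⟩
  (u * u) * (v * T m n)     ≡⟨ cong (_* (v * T m n)) ([-1]^n*[-1]^n≡1 m) ⟩
  1ℚ * (v * T m n)          ≡⟨ ℚ.*-identityˡ _ ⟩
  v * T m n                 ∎
  where
  T = binomialArray B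
  u = (- 1ℚ) ^ m
  v = (- 1ℚ) ^ n

  boundary : ∀ k → k > 1 → T 0 k ≡ T k 0
  -- Since `0 + i` reduces to `i`, `T 0 k` is the left side of the recursion by computation.
  boundary k k>1 = trans (IsBernoulli.B-recur isBernoulli k k>1) (sym (binomialArray-0 B k))
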